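{- For any graphs $G$ and $H$, $$\nu_I(G\odot H)=\begin{cases}|V(G)|\,\nu_I(H) & \text{if } E(H)\ne\emptyset,\\ \alpha(G) & \text{if } E(H)=\emptyset.\end{cases}$$
   Context: All graphs are finite and simple (with nonempty vertex set). A matching $M$ of a graph $G$ is an induced matching if no two distinct edges of $M$ are joined by an edge of $G$; $\nu_I(G)$ denotes the maximum cardinality of an induced matching in $G$. $\alpha(G)$ is the independence number of $G$. For graphs $G$ and $H$ with $V(G)=\{v_1,\ldots,v_n\}$, the corona product $G\odot H$ is obtained from the disjoint union of $G$ and $n$ disjoint copies $H_1,\ldots,H_n$ of $H$ by making $v_i$ adjacent to all vertices of $H_i$ for each $i\in\{1,\ldots,n\}$. -}

module Defs where

open import Data.Fin using (Fin; _<_; splitAt; remQuot)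
open import Data.Fin.Properties using (_≟_; _<?_; all?; any?)
open import Data.Fin.Subset using (Subset; _∈_; ∣_∣) renaming (⊥ to ∅)
open import Data.Fin.Subset.Properties using (anySubset?; _∈?_; ∣p∣≤n; ∉⊥)
open import Data.List using (List; length; lookup; filter; allFin; cartesianProduct)
open import Data.Nat as ℕ using (ℕ; zero; suc; _+_; _*_; _≤_; NonZero)
open import Data.Nat.Properties using (n≤0⇒n≡0; ≤∧≢⇒<; ≤-pred)
open import Data.Product using (_×_; _,_; ∃; ∃₂; ∃-syntax; proj₁; proj₂)
open import Data.Sum as Sum using (_⊎_; inj₁; inj₂)
open import Function using (_∘_; _on_)
open import Level using (0ℓ)
open import Relation.Binary using (Rel; Symmetric; Irreflexive) renaming (Decidable to Decidable₂)
open import Relation.Binary.PropositionalEquality using (_≡_; _≢_; refl; sym)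
open import Relation.Nullary using (¬_; Dec; yes; no; ¬?; contradiction)
open import Relation.Nullary.Decidable using (_×-dec_; _⊎-dec_; _→-dec_)
open import Relation.Unary using (Pred; Decidable)

record Graph : Set₁ where
  field
    order    : ℕ
    nonempty : NonZero order

  V : Set
  V = Fin order

  field
    Adj    : Rel V 0ℓ
    Adj?   : Decidable₂ Adj
    symm   : Symmetric Adj
    irrefl : Irreflexive _≡_ Adj

  -- Each edge {u , v} is listed exactly once, as the pair with u < v.
  E : List (V × V)
  E = filter (λ (u , v) → (u <? v) ×-dec Adj? u v)
             (cartesianProduct (allFin order) (allFin order))

  -- An edge is a position in E, so that a set of edges is a Subset (length E).
  Edge : Set
  Edge = Fin (length E)

  infix 4 _∈ᵉ_ _∈ᵉ?_

  _∈ᵉ_ : V → Edge → Set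
  v ∈ᵉ e = v ≡ proj₁ (lookup E e) ⊎ v ≡ proj₂ (lookup E e)

  ShareVertex : Rel Edge 0ℓ
  ShareVertex e f = ∃[ v ] v ∈ᵉ e × v ∈ᵉ f

  Joined : Rel Edge 0ℓ
  Joined e f = ∃₂ λ u v → u ∈ᵉ e × v ∈ᵉ f × Adj u v

  IsMatching : Pred (Subset (length E)) 0ℓ
  IsMatching M = ∀ e f → e ∈ M → f ∈ M → e ≢ f → ¬ ShareVertex e f

  IsInducedMatching : Pred (Subset (length E)) 0ℓ
  IsInducedMatching M =
    IsMatching M × (∀ e f → e ∈ M → f ∈ M → e ≢ f → ¬ Joined e f)

  IsIndependent : Pred (Subset order) 0ℓ
  IsIndependent S = ∀ u v → u ∈ S → v ∈ S → ¬ Adj u v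

  _∈ᵉ?_ : Decidable₂ _∈ᵉ_
  v ∈ᵉ? e = (v ≟ _) ⊎-dec (v ≟ _)

  isInducedMatching? : Decidable IsInducedMatching
  isInducedMatching? M =
    pairwise? (λ e f → any? λ v → (v ∈ᵉ? e) ×-dec (v ∈ᵉ? f))
      ×-dec
    pairwise? (λ e f → any? λ u → any? λ v →
                 (u ∈ᵉ? e) ×-dec (v ∈ᵉ? f) ×-dec Adj? u v)
    where
    pairwise? : {R : Rel Edge 0ℓ} → Decidable₂ R →
                Dec (∀ e f → e ∈ M → f ∈ M → e ≢ f → ¬ R e f)
    pairwise? R? = all? λ e → all? λ f →
      (e ∈? M) →-dec (f ∈? M) →-dec ¬? (e ≟ f) →-dec ¬? (R? e f)

  isIndependent? : Decidable IsIndependent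
  isIndependent? S = all? λ u → all? λ v →
    (u ∈? S) →-dec (v ∈? S) →-dec ¬? (Adj? u v)

record MaximumSize {n : ℕ} (P : Pred (Subset n) 0ℓ) : Set where
  field
    size     : ℕ
    attained : ∃[ S ] P S × ∣ S ∣ ≡ size
    upper    : ∀ S → P S → ∣ S ∣ ≤ size

maximumSize : ∀ {n} {P : Pred (Subset n) 0ℓ} → Decidable P → ∃ P → MaximumSize P
maximumSize {n} {P} P? (S₀ , p₀) = search n (λ S _ → ∣p∣≤n S)
  where
  search : ∀ b → (∀ S → P S → ∣ S ∣ ≤ b) → MaximumSize P
  search b bound with anySubset? (λ S → P? S ×-dec (∣ S ∣ ℕ.≟ b))
  search b bound | yes found = record { size = b ; attained = found ; upper = bound }
  search zero bound | no none =
    contradiction (S₀ , p₀ , n≤0⇒n≡0 (bound S₀ p₀)) none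
  search (suc b) bound | no none =
    search b λ S p → ≤-pred (≤∧≢⇒< (bound S p) λ eq → none (S , p , eq))

module _ (G : Graph) where
  open Graph G

  maximumInducedMatching : MaximumSize IsInducedMatching
  maximumInducedMatching = maximumSize isInducedMatching?
    (∅ , (λ _ _ e∈∅ → contradiction e∈∅ ∉⊥) , (λ _ _ e∈∅ → contradiction e∈∅ ∉⊥))

  maximumIndependent : MaximumSize IsIndependent
  maximumIndependent = maximumSize isIndependent?
    (∅ , λ _ _ u∈∅ → contradiction u∈∅ ∉⊥)

  νᴵ : ℕ
  νᴵ = MaximumSize.size maximumInducedMatching

  α : ℕ
  α = MaximumSize.size maximumIndependent

module Corona (G H : Graph) where
  private
    module G = Graph G
    module H = Graph H

  -- inj₁ i is the vertex vᵢ of G, and inj₂ (i , x) is the vertex x of the copy Hᵢ.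
  Vertex : Set
  Vertex = G.V ⊎ (G.V × H.V)

  infix 4 _~_ _~?_

  _~_ : Rel Vertex 0ℓ
  inj₁ i       ~ inj₁ j       = G.Adj i j
  inj₁ i       ~ inj₂ (j , y) = i ≡ j
  inj₂ (i , x) ~ inj₁ j       = i ≡ j
  inj₂ (i , x) ~ inj₂ (j , y) = i ≡ j × H.Adj x y

  _~?_ : Decidable₂ _~_
  inj₁ i       ~? inj₁ j       = G.Adj? i j
  inj₁ i       ~? inj₂ (j , y) = i ≟ j
  inj₂ (i , x) ~? inj₁ j       = i ≟ j
  inj₂ (i , x) ~? inj₂ (j , y) = (i ≟ j) ×-dec H.Adj? x y

  ~-sym : Symmetric _~_
  ~-sym {inj₁ _} {inj₁ _} a       = G.symm a
  ~-sym {inj₁ _} {inj₂ _} a       = sym a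
  ~-sym {inj₂ _} {inj₁ _} a       = sym a
  ~-sym {inj₂ _} {inj₂ _} (p , a) = sym p , H.symm a

  ~-irrefl : Irreflexive _≡_ _~_
  ~-irrefl {inj₁ _} refl a       = G.irrefl refl a
  ~-irrefl {inj₂ _} refl (_ , a) = H.irrefl refl a

  -- The forward direction of the bijection given by Data.Fin.Properties.+↔⊎ and *↔×.
  decode : Fin (G.order + G.order * H.order) → Vertex
  decode = Sum.map₂ (remQuot H.order) ∘ splitAt G.order

  corona : Graph
  corona = record
    { order    = G.order + G.order * H.order
    ; nonempty = nonZero-+ G.nonempty
    ; Adj      = _~_ on decode
    ; Adj?     = λ u v → decode u ~? decode v
    ; symm     = λ {u} {v} → ~-sym {decode u} {decode v}
    ; irrefl   = λ { {u} refl → ~-irrefl {decode u} refl }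
    }
    where
    nonZero-+ : ∀ {m n} → NonZero m → NonZero (m + n)
    nonZero-+ {suc _} _ = _

infixl 7 _⊙_
_⊙_ : Graph → Graph → Graph
_⊙_ = Corona.corona

{-# OPTIONS --safe #-}
-- An induced matching is a list of edges that are pairwise apart: no end of one is an end of, or
-- adjacent to, an end of another.  Every edge of G ⊙ H has an anchor, a vertex vᵢ of G that the
-- edge contains or whose copy Hᵢ contains the edge; in either case vᵢ is adjacent to an end.
-- If two edges of an induced matching have the same anchor vᵢ, then neither contains vᵢ, so both
-- lie in Hᵢ; hence at most νᴵ H edges (when H has an edge) are anchored at each vertex of G.
-- If H has no edge, every edge contains its anchor, so the anchors are distinct and independent.
module Submission where

open import Defs
open import Data.Fin using (Fin; zero; suc; toℕ; fromℕ<; join; combine; remQuot) renaming (_<_ to _<ᶠ_)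
open import Data.Fin.Properties
  using (toℕ<n; toℕ-injective; <-cmp; splitAt-join; remQuot-combine; _<?_)
open import Data.Fin.Subset using (Subset; inside; outside; _∈_; ⁅_⁆; ⋃; ∣_∣)
open import Data.Fin.Subset.Properties
  using (∉⊥; x∈⁅x⁆; x∈⁅y⁆⇒x≡y; x∈p∪q⁺; x∈p∪q⁻; x∈p∧x≢y⇒x∈p-y; x∈p⇒∣p-x∣<∣p∣)
open import Data.List
  using (List; []; _∷_; length; map; filter; lookup; allFin; cartesianProduct; cartesianProductWith)
open import Data.List.Membership.Propositional using () renaming (_∈_ to _∈ˡ_)
open import Data.List.Membership.Propositional.Properties
  using (∈-filter⁺; ∈-filter⁻; ∈-cartesianProduct⁺; ∈-allFin; ∈-lookup)
open import Data.List.Properties using (length-map; length-++; length-tabulate)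
open import Data.List.Relation.Unary.All as All using (All; []; _∷_)
import Data.List.Relation.Unary.All.Properties as All
open import Data.List.Relation.Unary.AllPairs as AllPairs using (AllPairs; []; _∷_)
import Data.List.Relation.Unary.AllPairs.Properties as AllPairs
open import Data.List.Relation.Unary.Any using (here; there; index)
open import Data.List.Relation.Unary.Any.Properties using (lookup-index)
open import Data.List.Relation.Unary.Unique.Propositional using (Unique)
open import Data.List.Relation.Unary.Unique.Propositional.Properties using (allFin⁺)
open import Data.Nat using (ℕ; zero; suc; _+_; _*_; _≤_; _<_; z≤n; >-nonZero⁻¹)
open import Data.Nat.Properties as ℕ using (module ≤-Reasoning)
open import Data.Product using (_×_; _,_; ∃-syntax; proj₁; proj₂)
open import Data.Sum as Sum using (_⊎_; inj₁; inj₂)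
open import Data.Vec using ([]; _∷_; here; there)
open import Function using (_∘_)
open import Level using (0ℓ)
open import Relation.Binary using (Rel; Symmetric; tri<; tri≈; tri>)
open import Relation.Binary.PropositionalEquality
  using (_≡_; _≢_; refl; sym; trans; cong; cong₂; subst; subst₂)
open import Relation.Nullary using (¬_; yes; no; ¬?; contradiction)
open import Relation.Nullary.Decidable using (_×-dec_)
open import Relation.Unary using (Decidable)

private
  variable
    A B C : Set
    R S : Rel A 0ℓ
    n : ℕ

-- Lists with pairwise related entries

-- `AllPairs` relates earlier entries to later ones only; symmetry covers the other order.
AllPairs-lookup : Symmetric R → ∀ {xs x y} → AllPairs R xs → x ∈ˡ xs → y ∈ˡ xs → x ≢ y → R x y
AllPairs-lookup R-sym (_ ∷ _)   (here refl)  (here refl)  x≢x = contradiction refl x≢x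
AllPairs-lookup R-sym (rx ∷ _)  (here refl)  (there y∈xs) _   = All.lookup rx y∈xs
AllPairs-lookup R-sym (ry ∷ _)  (there x∈xs) (here refl)  _   = R-sym (All.lookup ry x∈xs)
AllPairs-lookup R-sym (_ ∷ rxs) (there x∈xs) (there y∈xs) x≢y =
  AllPairs-lookup R-sym rxs x∈xs y∈xs x≢y

AllPairs-mapAll : ∀ {P : A → Set} → (∀ {x y} → P x → P y → R x y → S x y) →
                  ∀ {xs} → All P xs → AllPairs R xs → AllPairs S xs
AllPairs-mapAll f []         []         = []
AllPairs-mapAll f (px ∷ pxs) (rx ∷ rxs) =
  All.zipWith (λ (py , r) → f px py r) (pxs , rx) ∷ AllPairs-mapAll f pxs rxs

-- The product is a concatenation of blocks, one for each entry of `is`: `same` relates entries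
-- within a block, `diff` entries of different blocks.
AllPairs-cartesianProductWith :
  (f : A → B → C) {T : Rel C 0ℓ} → (∀ {i x y} → S x y → T (f i x) (f i y)) →
  (∀ {i j} x y → R i j → T (f i x) (f j y)) →
  ∀ {is xs} → AllPairs R is → AllPairs S xs → AllPairs T (cartesianProductWith f is xs)
AllPairs-cartesianProductWith f same diff []         sxs = []
AllPairs-cartesianProductWith {R = R} f {T} same diff {xs = xs} (ri ∷ ris) sxs = AllPairs.++⁺
  (AllPairs.map⁺ (AllPairs.map same sxs))
  (AllPairs-cartesianProductWith f same diff ris sxs)
  (All.map⁺ (All.universal (λ x → distinct x ri) _))
  where
  distinct : ∀ x {i js} → All (R i) js → All (T (f i x)) (cartesianProductWith f js xs)
  distinct x []         = []
  distinct x (rj ∷ rjs) =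
    All.++⁺ (All.map⁺ (All.universal (λ y → diff x y rj) _)) (distinct x rjs)

length-cartesianProductWith : (f : A → B → C) → ∀ xs ys →
                              length (cartesianProductWith f xs ys) ≡ length xs * length ys
length-cartesianProductWith f []       ys = refl
length-cartesianProductWith f (x ∷ xs) ys = trans (length-++ (map (f x) ys))
  (cong₂ _+_ (length-map (f x) ys) (length-cartesianProductWith f xs ys))

length-filter-∁ : ∀ {P : A → Set} (P? : Decidable P) xs →
                  length xs ≡ length (filter P? xs) + length (filter (¬? ∘ P?) xs)
length-filter-∁ P? []       = refl
length-filter-∁ P? (x ∷ xs) with P? x
... | yes _ = cong suc (length-filter-∁ P? xs)
... | no  _ = trans (cong suc (length-filter-∁ P? xs)) (sym (ℕ.+-suc _ _))

-- Induction on the bound: the entries taking the top value form a sublist, still pairwise related,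
-- hence of length at most `m`; the others fall under the smaller bound.
length≤fibres : (g : A → ℕ) → ∀ n {m} →
  (∀ {i xs} → All (λ x → g x ≡ i) xs → AllPairs R xs → length xs ≤ m) →
  ∀ {xs} → All (λ x → g x < n) xs → AllPairs R xs → length xs ≤ n * m
length≤fibres g zero fibre [] rxs = z≤n
length≤fibres g (suc n) {m} fibre {xs} g<1+n rxs = begin
  length xs                                             ≡⟨ length-filter-∁ top? xs ⟩
  length (filter top? xs) + length (filter (¬? ∘ top?) xs)
    ≤⟨ ℕ.+-mono-≤
         (fibre (All.all-filter top? xs) (AllPairs.filter⁺ top? rxs))
         (length≤fibres g n fibre
           (All.zipWith (λ (≢n , <1+n) → ℕ.≤∧≢⇒< (ℕ.≤-pred <1+n) ≢n)
             (All.all-filter (¬? ∘ top?) xs , All.filter⁺ (¬? ∘ top?) g<1+n))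
           (AllPairs.filter⁺ (¬? ∘ top?) rxs)) ⟩
  m + n * m                                             ∎
  where
  open ≤-Reasoning
  top? = λ x → g x ℕ.≟ n

-- Lists against subsets

enumerate : (p : Subset n) → ∃[ xs ] length xs ≡ ∣ p ∣ × Unique xs × All (_∈ p) xs
enumerate []            = [] , refl , [] , []
enumerate (s ∷ p)       with enumerate p
enumerate (outside ∷ p) | xs , eq , xs! , xs∈p =
  map suc xs , trans (length-map suc xs) eq ,
  AllPairs.map⁺ (AllPairs.map (λ x≢y → λ { refl → x≢y refl }) xs!) ,
  All.map⁺ (All.map there xs∈p)
enumerate (inside ∷ p)  | xs , eq , xs! , xs∈p =
  zero ∷ map suc xs , cong suc (trans (length-map suc xs) eq) ,
  All.map⁺ (All.universal (λ _ ()) xs) ∷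
    AllPairs.map⁺ (AllPairs.map (λ x≢y → λ { refl → x≢y refl }) xs!) ,
  here ∷ All.map⁺ (All.map there xs∈p)

-- `pairwise` speaks of distinct elements; listing the attaining subset without repetition supplies
-- the distinctness.
maximumList : ∀ {P} {R : Rel (Fin n) 0ℓ} (m : MaximumSize P) →
              (∀ p → P p → ∀ x y → x ∈ p → y ∈ p → x ≢ y → R x y) →
              ∃[ xs ] length xs ≡ MaximumSize.size m × AllPairs R xs
maximumList m pairwise
  with p , Pp , ∣p∣ ← MaximumSize.attained m
  with xs , eq , xs! , xs∈p ← enumerate p =
  xs , trans eq ∣p∣ , AllPairs-mapAll (pairwise p Pp _ _) xs∈p xs!

fromList : List (Fin n) → Subset n
fromList = ⋃ ∘ map ⁅_⁆

∈-fromList⁺ : ∀ {xs} {x : Fin n} → x ∈ˡ xs → x ∈ fromList xs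
∈-fromList⁺ (here refl)  = x∈p∪q⁺ (inj₁ (x∈⁅x⁆ _))
∈-fromList⁺ (there x∈xs) = x∈p∪q⁺ (inj₂ (∈-fromList⁺ x∈xs))

∈-fromList⁻ : ∀ xs {x : Fin n} → x ∈ fromList xs → x ∈ˡ xs
∈-fromList⁻ []       x∈ = contradiction x∈ ∉⊥
∈-fromList⁻ (y ∷ xs) x∈ with x∈p∪q⁻ ⁅ y ⁆ (fromList xs) x∈
... | inj₁ x∈⁅y⁆ = here (x∈⁅y⁆⇒x≡y y x∈⁅y⁆)
... | inj₂ x∈xs  = there (∈-fromList⁻ xs x∈xs)

-- Removing the head from `p` strictly lowers its size and keeps the other entries, which differ
-- from the head.
length≤∣∣ : ∀ {xs} {p : Subset n} → Unique xs → All (_∈ p) xs → length xs ≤ ∣ p ∣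
length≤∣∣ []           []           = z≤n
length≤∣∣ (x≢xs ∷ xs!) (x∈p ∷ xs∈p) = ℕ.≤-<-trans
  (length≤∣∣ xs! (All.zipWith (λ (x≢y , y∈p) → x∈p∧x≢y⇒x∈p-y y∈p (x≢y ∘ sym)) (x≢xs , xs∈p)))
  (x∈p⇒∣p-x∣<∣p∣ x∈p)

length≤∣fromList∣ : ∀ {xs : List (Fin n)} → Unique xs → length xs ≤ ∣ fromList xs ∣
length≤∣fromList∣ xs! = length≤∣∣ xs! (All.tabulate ∈-fromList⁺)

-- Edges of a relation

-- An edge with its ends in some order, over any relation, so that edges of `H`, of `Vertex` and of
-- the numbered corona are treated alike, free of positions in `E`.
record Arc {A : Set} (_~_ : Rel A 0ℓ) : Set where
  constructor arc
  field
    {src tgt} : A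
    adj       : src ~ tgt

open Arc

module _ {A : Set} {_~_ : Rel A 0ℓ} where

  infix 4 _∈ᵃ_

  _∈ᵃ_ : A → Arc _~_ → Set
  v ∈ᵃ e = v ≡ src e ⊎ v ≡ tgt e

  -- For a symmetric relation this also excludes a common vertex, which would be adjacent to the
  -- other end of either arc.
  Apart : Rel (Arc _~_) 0ℓ
  Apart e f = ∀ u v → u ∈ᵃ e → v ∈ᵃ f → ¬ u ~ v

module ArcMap {A B : Set} {_~_ : Rel A 0ℓ} {_≈_ : Rel B 0ℓ}
              (φ : A → B) (φ-hom : ∀ {u v} → u ~ v → φ u ≈ φ v) where

  mapArc : Arc _~_ → Arc _≈_
  mapArc (arc u~v) = arc (φ-hom u~v)

  ∈ᵃ-map⁻ : ∀ {v} e → v ∈ᵃ mapArc e → ∃[ u ] u ∈ᵃ e × v ≡ φ u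
  ∈ᵃ-map⁻ e (inj₁ eq) = src e , inj₁ refl , eq
  ∈ᵃ-map⁻ e (inj₂ eq) = tgt e , inj₂ refl , eq

  mapArc-apart : (∀ {u v} → φ u ≈ φ v → u ~ v) →
                 ∀ e f → Apart e f → Apart (mapArc e) (mapArc f)
  mapArc-apart φ-reflects e f ap u v u∈ v∈ u≈v
    with u′ , u′∈e , refl ← ∈ᵃ-map⁻ e u∈ | v′ , v′∈f , refl ← ∈ᵃ-map⁻ f v∈ =
    ap u′ v′ u′∈e v′∈f (φ-reflects u≈v)

-- Induced matchings and independent sets as lists

module _ (G : Graph) where
  open Graph G

  ∈E⁺ : ∀ {u v} → u <ᶠ v → Adj u v → (u , v) ∈ˡ E
  ∈E⁺ {u} {v} u<v uv =
    ∈-filter⁺ _ (∈-cartesianProduct⁺ (∈-allFin u) (∈-allFin v)) (u<v , uv)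

  edgeArc : Edge → Arc Adj
  edgeArc e = arc {src = proj₁ (lookup E e)} {tgt = proj₂ (lookup E e)} (proj₂ (proj₂
    (∈-filter⁻ (λ (u , v) → (u <? v) ×-dec Adj? u v)
      {xs = cartesianProduct (allFin order) (allFin order)} (∈-lookup {xs = E} e))))

  ∈E⇒edge : ∀ {u v} → (u , v) ∈ˡ E → ∃[ e ] lookup E e ≡ (u , v)
  ∈E⇒edge uv∈E = index uv∈E , sym (lookup-index uv∈E)

  -- `E` lists each edge with its smaller vertex first, so the arc may have to be reversed.
  -- Containment of the ends turns apartness of arcs into the negation of `Joined`.
  arcEdge : (a : Arc Adj) → ∃[ e ] (∀ v → v ∈ᵉ e → v ∈ᵃ a)
  arcEdge a with <-cmp (src a) (tgt a)
  ... | tri≈ _ u≡v _ = contradiction (adj a) (irrefl u≡v)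
  ... | tri< u<v _ _ with e , eq ← ∈E⇒edge (∈E⁺ u<v (adj a)) =
    e , λ v → Sum.map (λ p → trans p (cong proj₁ eq)) (λ p → trans p (cong proj₂ eq))
  ... | tri> _ _ v<u with e , eq ← ∈E⇒edge (∈E⁺ v<u (symm (adj a))) =
    e , λ v → Sum.swap ∘ Sum.map (λ p → trans p (cong proj₁ eq)) (λ p → trans p (cong proj₂ eq))

  -- The common vertex is adjacent to the other end of `f`. Hence the matching condition follows
  -- from the absence of joined pairs.
  shareVertex⇒joined : ∀ {e f} → ShareVertex e f → Joined e f
  shareVertex⇒joined {e} {f} (v , v∈e , inj₁ refl) = v , _ , v∈e , inj₂ refl , adj (edgeArc f)
  shareVertex⇒joined {e} {f} (v , v∈e , inj₂ refl) = v , _ , v∈e , inj₁ refl , symm (adj (edgeArc f))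

  joined-sym : Symmetric Joined
  joined-sym (u , v , u∈e , v∈f , uv) = v , u , v∈f , u∈e , symm uv

  joined-refl : ∀ e → Joined e e
  joined-refl e = _ , _ , inj₁ refl , inj₂ refl , adj (edgeArc e)

  maximumApart : ∃[ as ] length as ≡ νᴵ G × AllPairs (Apart {_~_ = Adj}) as
  maximumApart =
    let es , eq , es-apart = maximumList (maximumInducedMatching G) (λ _ → proj₂) in
    map edgeArc es , trans (length-map edgeArc es) eq ,
    AllPairs.map⁺ (AllPairs.map (λ ¬j u v u∈ v∈ uv → ¬j (u , v , u∈ , v∈ , uv)) es-apart)

  length≤νᴵ : ∀ {as} → AllPairs (Apart {_~_ = Adj}) as → length as ≤ νᴵ G
  length≤νᴵ {as} as-apart = begin
    length as       ≡⟨ length-map edge as ⟨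
    length es       ≤⟨ length≤∣fromList∣ es! ⟩
    ∣ fromList es ∣ ≤⟨ MaximumSize.upper (maximumInducedMatching G) (fromList es) (matching , induced) ⟩
    νᴵ G            ∎
    where
    open ≤-Reasoning
    edge = proj₁ ∘ arcEdge
    es = map edge as

    es-apart : AllPairs (λ e f → ¬ Joined e f) es
    es-apart = AllPairs.map⁺ (AllPairs.map
      (λ { {a} {b} ap (u , v , u∈ , v∈ , uv) →
           ap u v (proj₂ (arcEdge a) u u∈) (proj₂ (arcEdge b) v v∈) uv })
      as-apart)

    es! : Unique es
    -- An edge is joined to itself, so two apart arcs cannot give the same edge.
    es! = AllPairs.map (λ { ¬j refl → ¬j (joined-refl _) }) es-apart

    induced : ∀ e f → e ∈ fromList es → f ∈ fromList es → e ≢ f → ¬ Joined e f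
    induced e f e∈ f∈ = AllPairs-lookup (λ ¬j → ¬j ∘ joined-sym) es-apart
      (∈-fromList⁻ es e∈) (∈-fromList⁻ es f∈)

    matching : IsMatching (fromList es)
    matching e f e∈ f∈ e≢f = induced e f e∈ f∈ e≢f ∘ shareVertex⇒joined

  -- A vertex is not adjacent to itself, so nonadjacency alone would allow repetitions in a list.
  DistinctNonadjacent : Rel V 0ℓ
  DistinctNonadjacent u v = u ≢ v × ¬ Adj u v

  maximumIndependentList : ∃[ vs ] length vs ≡ α G × AllPairs DistinctNonadjacent vs
  maximumIndependentList = maximumList (maximumIndependent G)
    (λ _ independent u v u∈ v∈ u≢v → u≢v , independent u v u∈ v∈)

  length≤α : ∀ {vs} → AllPairs DistinctNonadjacent vs → length vs ≤ α G
  length≤α {vs} vs-indep = ℕ.≤-trans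
    (length≤∣fromList∣ (AllPairs.map proj₁ vs-indep))
    (MaximumSize.upper (maximumIndependent G) (fromList vs) λ u v u∈ v∈ uv →
      AllPairs-lookup (λ ¬vu → ¬vu ∘ symm) (AllPairs.map proj₂ vs-indep)
        -- The adjacency `uv` under refutation makes `u` and `v` distinct.
        (∈-fromList⁻ vs u∈) (∈-fromList⁻ vs v∈) (λ u≡v → irrefl u≡v uv) uv)

  E≢[]⇒arc : E ≢ [] → Arc Adj
  E≢[]⇒arc E≢[] with E in eq
  ... | []    = contradiction refl E≢[]
  ... | _ ∷ _ = edgeArc (subst (Fin ∘ length) (sym eq) zero)

  E≡[]⇒¬Adj : E ≡ [] → ∀ {u v} → ¬ Adj u v
  E≡[]⇒¬Adj E≡[] uv with () ← subst (Fin ∘ length) E≡[] (proj₁ (arcEdge (arc uv)))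

  -- Provides the end of a pendant edge inside each copy of `H`.
  vertex : V
  vertex = fromℕ< (>-nonZero⁻¹ order {{nonempty}})

-- Coronas

module _ (G H : Graph) where
  open Corona G H
  private
    module G = Graph G
    module H = Graph H
    module GH = Graph (G ⊙ H)

  encode : Vertex → GH.V
  encode = join G.order _ ∘ Sum.map₂ (λ (i , x) → combine i x)

  decode-encode : ∀ v → decode (encode v) ≡ v
  decode-encode (inj₁ i)       =
    cong (Sum.map₂ (remQuot H.order)) (splitAt-join G.order (G.order * H.order) (inj₁ i))
  decode-encode (inj₂ (i , x)) = trans
    (cong (Sum.map₂ (remQuot H.order)) (splitAt-join G.order (G.order * H.order) (inj₂ (combine i x))))
    (cong inj₂ (remQuot-combine i x))

  open ArcMap {_~_ = _~_} {_≈_ = GH.Adj} encode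
    (λ {u} {v} → subst₂ _~_ (sym (decode-encode u)) (sym (decode-encode v)))
    using () renaming (mapArc to encodeArc; mapArc-apart to encodeArc-apart)

  open ArcMap {_~_ = GH.Adj} {_≈_ = _~_} decode (λ uv → uv)
    using () renaming (mapArc to decodeArc; mapArc-apart to decodeArc-apart)

  length≤νᴵ-corona : ∀ {as} → AllPairs (Apart {_~_ = _~_}) as → length as ≤ νᴵ (G ⊙ H)
  length≤νᴵ-corona {as} as-apart = subst (_≤ νᴵ (G ⊙ H)) (length-map encodeArc as)
    (length≤νᴵ (G ⊙ H) (AllPairs.map⁺ (AllPairs.map
      (λ {a} {b} → encodeArc-apart
        (λ {u} {v} → subst₂ _~_ (decode-encode u) (decode-encode v)) a b) as-apart)))

  maximumApart-corona : ∃[ as ] length as ≡ νᴵ (G ⊙ H) × AllPairs (Apart {_~_ = _~_}) as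
  maximumApart-corona =
    let as , eq , as-apart = maximumApart (G ⊙ H) in
    map decodeArc as , trans (length-map decodeArc as) eq ,
    AllPairs.map⁺ (AllPairs.map (λ {a} {b} → decodeArc-apart (λ uv → uv) a b) as-apart)

  -- Lower bounds for the corona

  α≤νᴵ-corona : α G ≤ νᴵ (G ⊙ H)
  α≤νᴵ-corona =
    let vs , eq , vs-indep = maximumIndependentList G in
    subst (_≤ νᴵ (G ⊙ H)) (trans (length-map pendant vs) eq)
      (length≤νᴵ-corona (AllPairs.map⁺ (AllPairs.map pendant-apart vs-indep)))
    where
    -- The edge from `vᵢ` into its own copy; for `i` and `j` such edges fail to be apart only if `i`
    -- and `j` are equal or adjacent.
    pendant : G.V → Arc _~_
    pendant i = arc {src = inj₁ i} {tgt = inj₂ (i , vertex H)} refl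

    pendant-apart : ∀ {i j} → DistinctNonadjacent G i j → Apart (pendant i) (pendant j)
    pendant-apart (_ , ¬ij)  _ _ (inj₁ refl) (inj₁ refl) ij         = ¬ij ij
    pendant-apart (i≢j , _)  _ _ (inj₁ refl) (inj₂ refl) i≡j        = i≢j i≡j
    pendant-apart (i≢j , _)  _ _ (inj₂ refl) (inj₁ refl) i≡j        = i≢j i≡j
    pendant-apart (i≢j , _)  _ _ (inj₂ refl) (inj₂ refl) (i≡j , _)  = i≢j i≡j

  -- Every copy of `H` receives the same maximum induced matching: each copy is an induced subgraph,
  -- and no edge runs between two copies.
  order*νᴵ≤νᴵ-corona : G.order * νᴵ H ≤ νᴵ (G ⊙ H)
  order*νᴵ≤νᴵ-corona =
    let as , eq , as-apart = maximumApart H in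
    subst (_≤ νᴵ (G ⊙ H))
      (trans (length-cartesianProductWith copy (allFin G.order) as)
        (cong₂ _*_ (length-tabulate {n = G.order} (λ i → i)) eq))
      (length≤νᴵ-corona (AllPairs-cartesianProductWith copy
        (λ {i} {a} {b} → mapArc-apart i proj₂ a b) copy-apart (allFin⁺ G.order) as-apart))
    where
    open module Copy i = ArcMap {_~_ = H.Adj} {_≈_ = _~_} (λ x → inj₂ (i , x)) (refl ,_)
      using (mapArc-apart; ∈ᵃ-map⁻) renaming (mapArc to copy)

    copy-apart : ∀ {i j} a b → i ≢ j → Apart (copy i a) (copy j b)
    copy-apart {i} {j} a b i≢j u v u∈ v∈ uv
      with _ , _ , refl ← ∈ᵃ-map⁻ i a u∈ | _ , _ , refl ← ∈ᵃ-map⁻ j b v∈ = i≢j (proj₁ uv)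

  -- Upper bounds for the corona

  anchor : Arc _~_ → G.V
  anchor (arc {inj₁ i}       _) = i
  -- A source in `Hᵢ` forces the target to be `vᵢ` or to lie in `Hᵢ`.
  anchor (arc {inj₂ (i , _)} _) = i

  anchor-adj : ∀ e → ∃[ v ] v ∈ᵃ e × inj₁ (anchor e) ~ v
  anchor-adj (arc {inj₁ _}       {v} uv) = v , inj₂ refl , uv
  anchor-adj (arc {inj₂ (_ , _)}     _)  = _ , inj₁ refl , refl

  -- Were the anchors equal, the end of `f` adjacent to its anchor would be adjacent to `anchor e`,
  -- an end of `e`.
  apart⇒anchor≢ : ∀ e f → Apart e f → inj₁ (anchor e) ∈ᵃ e → anchor e ≢ anchor f
  apart⇒anchor≢ e f ap i∈e eq with v , v∈f , iv ← anchor-adj f =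
    ap _ v i∈e v∈f (subst (λ i → inj₁ i ~ v) (sym eq) iv)

  Apart-sym : ∀ (e f : Arc _~_) → Apart e f → Apart f e
  Apart-sym e f ap u v u∈ v∈ uv = ap v u v∈ u∈ (~-sym {u} {v} uv)

  -- The matching is counted by fibres of `anchor`. Each fibre projects to pairwise apart arcs of
  -- `H`; a lone edge through `vᵢ` is replaced by `default`, so that it still counts as one.
  νᴵ-corona≤order*νᴵ : Arc H.Adj → νᴵ (G ⊙ H) ≤ G.order * νᴵ H
  νᴵ-corona≤order*νᴵ default =
    let as , eq , as-apart = maximumApart-corona in
    subst (_≤ G.order * νᴵ H) eq
      (length≤fibres (toℕ ∘ anchor) G.order
        (λ {_} {bs} same bs-apart → subst (_≤ νᴵ H) (length-map project bs)
          (length≤νᴵ H (AllPairs.map⁺ (AllPairs-mapAll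
            (λ p q → project-apart _ _ (toℕ-injective (trans p (sym q)))) same bs-apart))))
        (All.universal (toℕ<n ∘ anchor) as) as-apart)
    where
    -- The default value is only taken by edges containing their anchor, which no other
    -- edge of an induced matching has as its anchor.
    project : Arc _~_ → Arc H.Adj
    project (arc {inj₁ _} {_}      _)        = default
    project (arc {inj₂ _} {inj₁ _} _)        = default
    project (arc {inj₂ _} {inj₂ _} (_ , xy)) = arc xy

    project-apart : ∀ e f → anchor e ≡ anchor f → Apart e f → Apart (project e) (project f)
    project-apart e@(arc {inj₁ _} _) f eq ap =
      contradiction eq (apart⇒anchor≢ e f ap (inj₁ refl))
    project-apart e@(arc {inj₂ _} {inj₁ _} refl) f eq ap =
      contradiction eq (apart⇒anchor≢ e f ap (inj₂ refl))
    project-apart e@(arc {inj₂ _} {inj₂ _} _) f@(arc {inj₁ _} _) eq ap =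
      contradiction (sym eq) (apart⇒anchor≢ f e (Apart-sym e f ap) (inj₁ refl))
    project-apart e@(arc {inj₂ _} {inj₂ _} _) f@(arc {inj₂ _} {inj₁ _} refl) eq ap =
      contradiction (sym eq) (apart⇒anchor≢ f e (Apart-sym e f ap) (inj₂ refl))
    -- Both edges lie in the same copy `Hᵢ`, so an adjacency between their projections lifts to the
    -- corona.
    project-apart (arc {inj₂ (i , _)} {inj₂ _} (refl , _)) (arc {inj₂ _} {inj₂ _} (refl , _)) refl ap
      u v u∈ v∈ uv =
      ap (inj₂ (i , u)) (inj₂ (i , v)) (Sum.map lift lift u∈) (Sum.map lift lift v∈) (refl , uv)
      where
      lift : ∀ {x y} → x ≡ y → inj₂ (i , x) ≡ inj₂ (i , y)
      lift = cong (λ x → inj₂ (i , x))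

  νᴵ-corona≤α : (∀ {x y} → ¬ H.Adj x y) → νᴵ (G ⊙ H) ≤ α G
  νᴵ-corona≤α ¬xy =
    let as , eq , as-apart = maximumApart-corona in
    subst (_≤ α G) (trans (length-map anchor as) eq)
      (length≤α G (AllPairs.map⁺ (AllPairs.map
        -- The anchors are ends of `e` and `f`, so apartness itself makes them nonadjacent.
        (λ {e} {f} ap → apart⇒anchor≢ e f ap (anchor∈ e) , ap _ _ (anchor∈ e) (anchor∈ f)) as-apart)))
    where
    anchor∈ : ∀ e → inj₁ (anchor e) ∈ᵃ e
    anchor∈ (arc {inj₁ _}          _)        = inj₁ refl
    anchor∈ (arc {inj₂ _} {inj₁ _} refl)     = inj₂ refl
    anchor∈ (arc {inj₂ _} {inj₂ _} (_ , xy)) = contradiction xy ¬xy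

corollary6p2 : (G H : Graph) →
    (Graph.E H ≢ [] → νᴵ (G ⊙ H) ≡ Graph.order G * νᴵ H) ×
    (Graph.E H ≡ [] → νᴵ (G ⊙ H) ≡ α G)
corollary6p2 G H =
  (λ E≢[] → ℕ.≤-antisym (νᴵ-corona≤order*νᴵ G H (E≢[]⇒arc H E≢[])) (order*νᴵ≤νᴵ-corona G H)) ,
  (λ E≡[] → ℕ.≤-antisym (νᴵ-corona≤α G H (E≡[]⇒¬Adj H E≡[])) (α≤νᴵ-corona G H))
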